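{- Let $N$ be an odd perfect number with canonical factorization $N = \prod_{i=1}^{t} p_i^{\alpha_i}$, where $p_1 < p_2 < \cdots < p_t$ are primes, $t = \omega(N)$, and $\alpha_i > 0$ for all $i$. Then for every $i$ with $1 \le i \le t$, $$\sigma(p_i^{\alpha_i}) \le \frac{2}{3}\cdot\frac{N}{p_i^{\alpha_i}}.$$
   Context: $\sigma(n)$ denotes the sum of the positive divisors of $n$; $\omega(n)$ is the number of distinct prime divisors of $n$. An odd perfect number is an odd positive integer $N$ with $\sigma(N)=2N$. -}

module Defs where

open import Data.Nat using (ℕ; suc; _+_; _*_; _^_; _<_)
open import Data.Nat.Divisibility using (_∣_; _∣?_)
open import Data.List using (List; filter; map; upTo)
open import Data.Nat.ListAction using (sum)
open import Data.Product using (_×_)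
open import Relation.Nullary using (¬_)
open import Relation.Binary.PropositionalEquality using (_≡_)

divisors : ℕ → List ℕ
divisors n = filter (λ d → d ∣? n) (map suc (upTo n))

σ : ℕ → ℕ
σ n = sum (divisors n)

Odd : ℕ → Set
Odd N = ¬ (2 ∣ N)

OddPerfect : ℕ → Set
OddPerfect N = (0 < N) × Odd N × (σ N ≡ 2 * N)

-- p ^ a exactly divides N  (p^a ∥ N): p^a ∣ N and p^(a+1) ∤ N.
-- For p prime and a > 0 this says p^a is a factor p_i^{α_i} of the canonical factorization of N.
_^_∥_ : ℕ → ℕ → ℕ → Set
p ^ a ∥ N = (p ^ a ∣ N) × ¬ (p ^ suc a ∣ N)

{-# OPTIONS --safe #-}
-- Write N = q m with q = p^a and p ∤ m.  Then σ(q) σ(m) = 2 q m and σ(q) is prime to q, so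
-- 2m = k σ(q) and σ(m) = k q for some k, and the claim is that k ≥ 3.
--
-- k = 1: since 2m = σ(p^a) is even, a + 1 = 2c and m = u v with u = (p^c + 1)/2 and
-- v = 1 + p + ⋯ + p^(c-1) coprime.  As σ(u) σ(v) = p^a, both factors are powers of p; for c ≥ 2
-- both exceed p^(c-1), hence p^a ≥ p^(2c), which is absurd.  For c = 1, σ(m) = p is prime, so
-- m = r^e is a prime power and 2 r^e = σ(r^e) + 1 forces r ∣ 2.
--
-- k = 2: σ(m) = 2 p^a, so each prime power r^e ∥ m but one has σ(r^e) a power of p, hence e even
-- and r^(e+1) ≡ 1 (mod p); the exceptional one has σ(r^e) = 2 p^i, hence e and f = (e+1)/2 odd
-- and r^f ≡ -1 (mod p).  So m^K ≡ -1 (mod p) for some odd K, whereas m = σ(p^a) ≡ 1 (mod p).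
module Submission where

open import Defs
open import Data.Empty using (⊥)
open import Data.List using (List; []; _∷_; map; upTo; cartesianProduct)
open import Data.List.Membership.Propositional using (_∈_)
open import Data.List.Membership.Propositional.Properties using (∈-map⁺; ∈-map⁻; ∈-filter⁺; ∈-filter⁻; ∈-upTo⁺; ∈-cartesianProduct⁺; ∈-cartesianProduct⁻)
open import Data.List.Membership.Propositional.Properties.WithK using (unique∧set⇒bag)
open import Data.List.Properties using (map-++; map-∘)
open import Data.List.Relation.Binary.BagAndSetEquality using (∼bag⇒↭)
open import Data.List.Relation.Unary.All as All using (_∷_)
open import Data.List.Relation.Unary.AllPairs using ([]; _∷_)
open import Data.List.Relation.Unary.Any using (here; there)
open import Data.List.Relation.Unary.Unique.Propositional using (Unique)
import Data.List.Relation.Unary.Unique.Propositional.Properties as Unique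
open import Data.Nat using (ℕ; zero; suc; _+_; _*_; _^_; _/_; pred; _<_; _≤_; s≤s; z<s; s<s; NonZero; ≢-nonZero; ≢-nonZero⁻¹; >-nonZero; nonTrivial⇒n>1)
open import Data.Nat.Coprimality using (Coprime; coprime-divisor; coprime-/gcd) renaming (sym to coprime-sym)
open import Data.Nat.Divisibility
open import Data.Nat.DivMod using (m*[n/m]≡n)
open import Data.Nat.GCD using (gcd; gcd[m,n]∣m; gcd[m,n]∣n; gcd[m,n]≢0)
open import Data.Nat.Induction using (<-rec)
open import Data.Nat.ListAction using (sum)
open import Data.Nat.ListAction.Properties using (sum-++; sum-↭)
open import Data.Nat.Primality using (Prime; euclidsLemma; prime⇒nonZero; prime⇒nonTrivial; prime⇒irreducible; prime[2])
open import Data.Nat.Primality.Factorisation using (factorise)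
open import Data.Nat.Properties
open import Data.Nat.Tactic.RingSolver using (solve-∀)
open import Data.Product using (∃; ∃₂; _×_; _,_; proj₁; proj₂; uncurry)
open import Data.Sum using (_⊎_; inj₁; inj₂)
open import Function using (_∘_; mk⇔; _⇔_; Equivalence)
open import Relation.Binary.PropositionalEquality using (_≡_; _≢_; refl; sym; trans; cong; cong₂; subst; module ≡-Reasoning)
open import Relation.Nullary using (yes; no; contradiction)

-- Divisor sums

∈-divisors⁺ : ∀ {n d} .{{_ : NonZero n}} → d ∣ n → d ∈ divisors n
∈-divisors⁺ {n} {zero} d∣n = contradiction (0∣⇒≡0 d∣n) (≢-nonZero⁻¹ n)
∈-divisors⁺ {n} {suc d} d∣n = ∈-filter⁺ (_∣? n) (∈-map⁺ suc (∈-upTo⁺ (∣⇒≤ d∣n))) d∣n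

∈-divisors⁻ : ∀ {n d} → d ∈ divisors n → d ∣ n
∈-divisors⁻ {n} d∈ = proj₂ (∈-filter⁻ (_∣? n) {xs = map suc (upTo n)} d∈)

divisors-unique : ∀ n → Unique (divisors n)
divisors-unique n = Unique.filter⁺ (_∣? n) (Unique.map⁺ suc-injective (Unique.upTo⁺ n))

-- Two duplicate-free lists with the same members are permutations of each other, so `σ` may be
-- computed from any convenient enumeration of the divisors.
σ≡sum : ∀ {n xs} .{{_ : NonZero n}} → Unique xs → (∀ {d} → d ∣ n ⇔ d ∈ xs) → σ n ≡ sum xs
σ≡sum {n} xs! n⇔ = sum-↭ (∼bag⇒↭ (unique∧set⇒bag (divisors-unique n) xs!
  (mk⇔ (Equivalence.to n⇔ ∘ ∈-divisors⁻) (∈-divisors⁺ ∘ Equivalence.from n⇔))))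

∈⇒≤sum : ∀ {x xs} → x ∈ xs → x ≤ sum xs
∈⇒≤sum {x} {_ ∷ xs} (here refl) = m≤m+n x (sum xs)
∈⇒≤sum {x} {y ∷ _} (there x∈) = ≤-trans (∈⇒≤sum x∈) (m≤n+m _ y)

n≤σ : ∀ n → .{{NonZero n}} → n ≤ σ n
n≤σ n = ∈⇒≤sum (∈-divisors⁺ ∣-refl)

sum-map-* : ∀ c xs → sum (map (c *_) xs) ≡ c * sum xs
sum-map-* c [] = sym (*-zeroʳ c)
sum-map-* c (x ∷ xs) = trans (cong (c * x +_) (sum-map-* c xs)) (sym (*-distribˡ-+ c x (sum xs)))

sum-products : ∀ xs ys → sum (map (uncurry _*_) (cartesianProduct xs ys)) ≡ sum xs * sum ys
sum-products [] ys = refl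
sum-products (x ∷ xs) ys = begin
  sum (map (uncurry _*_) (cartesianProduct (x ∷ xs) ys))
    ≡⟨ cong sum (map-++ (uncurry _*_) (map (x ,_) ys) _) ⟩
  _ ≡⟨ sum-++ (map (uncurry _*_) (map (x ,_) ys)) _ ⟩
  sum (map (uncurry _*_) (map (x ,_) ys)) + sum (map (uncurry _*_) (cartesianProduct xs ys))
    ≡⟨ cong₂ _+_ (trans (cong sum (sym (map-∘ ys))) (sum-map-* x ys)) (sum-products xs ys) ⟩
  x * sum ys + sum xs * sum ys
    ≡⟨ *-distribʳ-+ (sum ys) x (sum xs) ⟨
  (x + sum xs) * sum ys ∎
  where open ≡-Reasoning

-- Injectivity is asked only on members of `xs`: multiplication is injective on pairs of divisors of
-- coprime numbers, not on all pairs.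
map-unique : ∀ {A B : Set} (f : A → B) {xs} →
             (∀ {x y} → x ∈ xs → y ∈ xs → f x ≡ f y → x ≡ y) → Unique xs → Unique (map f xs)
map-unique f inj [] = []
map-unique f {x ∷ xs} inj (x∉ ∷ xs!) =
  All.tabulate fresh ∷ map-unique f (λ y∈ z∈ → inj (there y∈) (there z∈)) xs!
  where
  fresh : ∀ {z} → z ∈ map f xs → f x ≢ z
  fresh z∈ fx≡z with y , y∈ , z≡fy ← ∈-map⁻ f z∈ =
    All.lookup x∉ y∈ (inj (here refl) (there y∈) (trans fx≡z z≡fy))

-- Multiplicativity of σ on coprime factors

coprime-∣ : ∀ {m n d e} → Coprime m n → d ∣ m → e ∣ n → Coprime d e
coprime-∣ m⊥n d∣m e∣n (c∣d , c∣e) = m⊥n (∣-trans c∣d d∣m , ∣-trans c∣e e∣n)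

-- For g = gcd(d, m), the quotient d/g is coprime to m/g and divides (m/g) n, hence divides n; so x
-- = g and y = d/g serve.
∣*-split : ∀ {d m n} .{{_ : NonZero m}} → d ∣ m * n → ∃₂ λ x y → x ∣ m × y ∣ n × d ≡ x * y
∣*-split {d} {m} {n} d∣mn =
  g , d / g , gcd[m,n]∣n d m , coprime-divisor (coprime-/gcd d m) d/g∣ , sym (m*[n/m]≡n (gcd[m,n]∣m d m))
  where
  g : ℕ
  g = gcd d m
  instance
    g≢0 : NonZero g
    g≢0 = ≢-nonZero (gcd[m,n]≢0 d m (inj₂ (≢-nonZero⁻¹ m)))
  d/g∣ : d / g ∣ (m / g) * n
  d/g∣ = *-cancelˡ-∣ g (subst (_∣ g * ((m / g) * n)) (sym (m*[n/m]≡n (gcd[m,n]∣m d m)))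
    (subst (d ∣_) (trans (cong (_* n) (sym (m*[n/m]≡n (gcd[m,n]∣n d m)))) (*-assoc g (m / g) n)) d∣mn))

-- `x` divides `x′ * y′` and is coprime to `y′`, so it divides `x′`. By symmetry `x` and `x′` agree,
-- and then `x` cancels.
coprime-*-injective : ∀ {m n x y x′ y′} .{{_ : NonZero m}} → Coprime m n →
  x ∣ m → y ∣ n → x′ ∣ m → y′ ∣ n → x * y ≡ x′ * y′ → (x , y) ≡ (x′ , y′)
coprime-*-injective {m} {n} {x} {y} {x′} {y′} m⊥n x∣m y∣n x′∣m y′∣n eq = cong₂ _,_ x≡x′ y≡y′
  where
  half-eq : ∀ {x y x′ y′} → x ∣ m → y′ ∣ n → x * y ≡ x′ * y′ → x ∣ x′
  half-eq {x} {y} {x′} {y′} x∣m y′∣n eq = coprime-divisor (coprime-∣ m⊥n x∣m y′∣n)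
    (subst (x ∣_) (trans eq (*-comm x′ y′)) (m∣m*n y))
  x≡x′ : x ≡ x′
  x≡x′ = ∣-antisym (half-eq x∣m y′∣n eq) (half-eq x′∣m y∣n (sym eq))
  instance
    x≢0 : NonZero x
    x≢0 = ≢-nonZero λ { refl → ≢-nonZero⁻¹ m (0∣⇒≡0 x∣m) }
  y≡y′ : y ≡ y′
  y≡y′ = *-cancelˡ-≡ y y′ x (trans eq (cong (_* y′) (sym x≡x′)))

-- Each divisor of m n is x y for exactly one pair of divisors x of m and y of n, so the divisor sum
-- is a sum over pairs and factors.
σ-* : ∀ m n .{{_ : NonZero m}} .{{_ : NonZero n}} → Coprime m n → σ (m * n) ≡ σ m * σ n
σ-* m n m⊥n = trans (σ≡sum unique (mk⇔ to from)) (sum-products (divisors m) (divisors n))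
  where
  pairs : List (ℕ × ℕ)
  pairs = cartesianProduct (divisors m) (divisors n)
  instance
    mn≢0 : NonZero (m * n)
    mn≢0 = m*n≢0 m n
  ∈-pairs⁻ : ∀ {x y} → (x , y) ∈ pairs → x ∣ m × y ∣ n
  ∈-pairs⁻ xy∈ with x∈ , y∈ ← ∈-cartesianProduct⁻ (divisors m) (divisors n) xy∈ =
    ∈-divisors⁻ x∈ , ∈-divisors⁻ y∈
  unique : Unique (map (uncurry _*_) pairs)
  unique = map-unique (uncurry _*_)
    (λ p∈ q∈ → let x∣m , y∣n = ∈-pairs⁻ p∈ ; x′∣m , y′∣n = ∈-pairs⁻ q∈ in
       coprime-*-injective m⊥n x∣m y∣n x′∣m y′∣n)
    (Unique.cartesianProduct⁺ (divisors-unique m) (divisors-unique n))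
  to : ∀ {d} → d ∣ m * n → d ∈ map (uncurry _*_) pairs
  to d∣mn with x , y , x∣m , y∣n , refl ← ∣*-split {m = m} d∣mn =
    ∈-map⁺ (uncurry _*_) (∈-cartesianProduct⁺ (∈-divisors⁺ x∣m) (∈-divisors⁺ y∣n))
  from : ∀ {d} → d ∈ map (uncurry _*_) pairs → d ∣ m * n
  from d∈ with _ , p∈ , refl ← ∈-map⁻ (uncurry _*_) d∈ = uncurry *-pres-∣ (∈-pairs⁻ p∈)

-- Prime powers

1<prime : ∀ {p} → Prime p → 1 < p
1<prime {p} pp = nonTrivial⇒n>1 p {{prime⇒nonTrivial pp}}

prime∤1 : ∀ {p} → Prime p → p ∤ 1
prime∤1 pp p∣1 = <⇒≢ (1<prime pp) (sym (∣1⇒≡1 p∣1))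

prime∣^⇒∣ : ∀ {p} → Prime p → ∀ x n → p ∣ x ^ n → p ∣ x
prime∣^⇒∣ pp x zero p∣1 = contradiction p∣1 (prime∤1 pp)
prime∣^⇒∣ pp x (suc n) p∣ with euclidsLemma x (x ^ n) pp p∣
... | inj₁ p∣x = p∣x
... | inj₂ p∣xⁿ = prime∣^⇒∣ pp x n p∣xⁿ

m*[n*o]≡n*[m*o] : ∀ m n o → m * (n * o) ≡ n * (m * o)
m*[n*o]≡n*[m*o] = solve-∀

m*[n*o]≡n*m*o : ∀ m n o → m * (n * o) ≡ n * m * o
m*[n*o]≡n*m*o = solve-∀

m*[n*o]≡n*[o*m] : ∀ m n o → m * (n * o) ≡ n * (o * m)
m*[n*o]≡n*[o*m] = solve-∀

factors-of-prime-power : ∀ {p} → Prime p → ∀ a x y → x * y ≡ p ^ a →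
                         ∃₂ λ i j → x ≡ p ^ i × y ≡ p ^ j × i + j ≡ a
factors-of-prime-power pp zero x y xy≡1 = 0 , 0 , m*n≡1⇒m≡1 x y xy≡1 , m*n≡1⇒n≡1 x y xy≡1 , refl
factors-of-prime-power {p} pp (suc a) x y eq
  with euclidsLemma x y pp (subst (p ∣_) (sym eq) (m∣m*n (p ^ a)))
... | inj₁ (divides x′ refl)
  with i , j , refl , refl , refl ← factors-of-prime-power pp a x′ y
         (*-cancelˡ-≡ (x′ * y) (p ^ a) p {{prime⇒nonZero pp}} (trans (m*[n*o]≡n*m*o p x′ y) eq))
  = suc i , j , *-comm (p ^ i) p , refl , refl
... | inj₂ (divides y′ refl)
  with i , j , refl , refl , refl ← factors-of-prime-power pp a x y′
         (*-cancelˡ-≡ (x * y′) (p ^ a) p {{prime⇒nonZero pp}} (trans (m*[n*o]≡n*[o*m] p x y′) eq))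
  = i , suc j , refl , *-comm (p ^ j) p , +-suc i j

factors-of-twice-prime-power : ∀ {p} → Prime p → ∀ a x y → x * y ≡ 2 * p ^ a →
  ∃₂ λ i j → (x ≡ 2 * p ^ i × y ≡ p ^ j) ⊎ (x ≡ p ^ i × y ≡ 2 * p ^ j)
factors-of-twice-prime-power {p} pp a x y eq
  with euclidsLemma x y prime[2] (subst (2 ∣_) (sym eq) (m∣m*n (p ^ a)))
... | inj₁ (divides x′ refl)
  with i , j , refl , refl , _ ← factors-of-prime-power pp a x′ y
         (*-cancelˡ-≡ (x′ * y) (p ^ a) 2 (trans (m*[n*o]≡n*m*o 2 x′ y) eq))
  = i , j , inj₁ (*-comm (p ^ i) 2 , refl)
... | inj₂ (divides y′ refl)
  with i , j , refl , refl , _ ← factors-of-prime-power pp a x y′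
         (*-cancelˡ-≡ (x * y′) (p ^ a) 2 (trans (m*[n*o]≡n*[o*m] 2 x y′) eq))
  = i , j , inj₂ (refl , *-comm (p ^ j) 2)

∤⇒coprime-^ : ∀ {p n} → Prime p → p ∤ n → ∀ a → Coprime (p ^ a) n
∤⇒coprime-^ {p} pp p∤n a {d} (divides q eq , d∣n)
  with factors-of-prime-power pp a d q (trans (*-comm d q) (sym eq))
... | zero , _ , d≡1 , _ = d≡1
... | suc i , _ , refl , _ = contradiction (∣-trans (m∣m*n (p ^ i)) d∣n) p∤n

split-prime-power : ∀ {p} → Prime p → ∀ n → .{{NonZero n}} → ∃₂ λ a m → n ≡ p ^ a * m × p ∤ m
split-prime-power {p} pp = <-rec (λ n → .{{NonZero n}} → ∃₂ λ a m → n ≡ p ^ a * m × p ∤ m) step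
  where
  step : ∀ n → (∀ {k} → k < n → .{{NonZero k}} → ∃₂ λ a m → k ≡ p ^ a * m × p ∤ m) →
         .{{NonZero n}} → ∃₂ λ a m → n ≡ p ^ a * m × p ∤ m
  step n rec with p ∣? n
  ... | no p∤n = 0 , n , sym (*-identityˡ n) , p∤n
  ... | yes p∣n
    with a , m , eq , p∤m ← rec (quotient-< p∣n {{prime⇒nonTrivial pp}}) {{quotient≢0 p∣n}}
    = suc a , m , trans (m∣n⇒n≡m*quotient p∣n) (trans (cong (p *_) eq) (sym (*-assoc p (p ^ a) m))) , p∤m

prime-divisor : ∀ n → 1 < n → ∃ λ p → Prime p × p ∣ n
prime-divisor n 1<n with factorise n {{>-nonZero (<-trans z<s 1<n)}}
... | record { factors = [] ; isFactorisation = n≡1 } = contradiction (sym n≡1) (<⇒≢ 1<n)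
... | record { factors = p ∷ ps ; isFactorisation = eq ; factorsPrime = pp ∷ _ } =
  p , pp , subst (p ∣_) (sym eq) (m∣m*n _)

-- The exponent is stored minus one, which makes it positive by construction.
record PrimeComponent (n : ℕ) : Set where
  constructor component
  field
    base       : ℕ
    exponent-1 : ℕ
    cofactor   : ℕ
    base-prime : Prime base
    coprime    : base ∤ cofactor
    factored   : n ≡ base ^ suc exponent-1 * cofactor

prime-component : ∀ n → 1 < n → PrimeComponent n
prime-component n 1<n
  with p , pp , p∣n ← prime-divisor n 1<n
  with split-prime-power pp n {{>-nonZero (<-trans z<s 1<n)}}
... | zero , m , eq , p∤m = contradiction (subst (p ∣_) (trans eq (*-identityˡ m)) p∣n) p∤m
... | suc e , m , eq , p∤m = component p e m pp p∤m eq

∤⇒nonZero : ∀ {p n} → p ∤ n → NonZero n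
∤⇒nonZero {p} p∤n = ≢-nonZero λ { refl → p∤n (p ∣0) }

σ-component : ∀ {p} → Prime p → ∀ a {m} → p ∤ m → σ (p ^ a * m) ≡ σ (p ^ a) * σ m
σ-component {p} pp a {m} p∤m = σ-* (p ^ a) m (∤⇒coprime-^ pp p∤m a)
  where
  instance
    p≢0 : NonZero p
    p≢0 = prime⇒nonZero pp
    pᵃ≢0 : NonZero (p ^ a)
    pᵃ≢0 = m^n≢0 p a
    m≢0 : NonZero m
    m≢0 = ∤⇒nonZero p∤m

-- Geometric sums 1 + r + ⋯ + r^(n-1)

geom : ℕ → ℕ → ℕ
geom r zero = 0
geom r (suc n) = 1 + r * geom r n

geom-+ : ∀ r m n → geom r (m + n) ≡ geom r m + r ^ m * geom r n
geom-+ r zero n = sym (*-identityˡ (geom r n))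
geom-+ r (suc m) n = trans (cong (λ g → 1 + r * g) (geom-+ r m n)) (expand r (geom r m) (r ^ m) (geom r n))
  where
  expand : ∀ r g q h → 1 + r * (g + q * h) ≡ 1 + r * g + r * q * h
  expand = solve-∀

-- This factorization is the source of the parity facts, of the residue -1 and of the splitting m =
-- u v.
geom-double : ∀ r n → geom r (n + n) ≡ (1 + r ^ n) * geom r n
geom-double r n = geom-+ r n n

-- The identity r^n - 1 = (r - 1)(1 + r + ⋯ + r^(n-1)), with the 1 moved across.
geom-closed : ∀ r n .{{_ : NonZero r}} → r ^ n ≡ 1 + pred r * geom r n
geom-closed (suc r) zero = sym (cong suc (*-zeroʳ r))
geom-closed (suc r) (suc n) = trans (cong (suc r *_) (geom-closed (suc r) n)) (expand r (geom (suc r) n))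
  where
  expand : ∀ r g → (1 + r) * (1 + r * g) ≡ 1 + r * (1 + (1 + r) * g)
  expand = solve-∀

geom≡1⇒≡1 : ∀ r n .{{_ : NonZero r}} → geom r n ≡ 1 → n ≡ 1
geom≡1⇒≡1 _ (suc zero) _ = refl
geom≡1⇒≡1 (suc _) (suc (suc _)) ()

∤geom-suc : ∀ {p} → Prime p → ∀ n → p ∤ geom p (suc n)
∤geom-suc {p} pp n p∣ = prime∤1 pp (∣m+n∣m⇒∣n (subst (p ∣_) (+-comm 1 (p * geom p n)) p∣) (m∣m*n (geom p n)))

-- The divisors of p^(a+1) are 1 and the p-fold divisors of p^a, which is the recursion of `geom`.
σ-^ : ∀ {p} → Prime p → ∀ a → σ (p ^ a) ≡ geom p (suc a)
σ-^ {p} pp zero = cong suc (sym (*-zeroʳ p))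
σ-^ {p} pp (suc a) = trans (σ≡sum unique (mk⇔ to from))
  (cong suc (trans (sum-map-* p (divisors (p ^ a))) (cong (p *_) (σ-^ pp a))))
  where
  instance
    p≢0 : NonZero p
    p≢0 = prime⇒nonZero pp
    pᵃ≢0 : NonZero (p ^ a)
    pᵃ≢0 = m^n≢0 p a
    pᵃ⁺¹≢0 : NonZero (p ^ suc a)
    pᵃ⁺¹≢0 = m^n≢0 p (suc a)
  multiples : List ℕ
  multiples = map (p *_) (divisors (p ^ a))
  1∉ : ∀ {d} → d ∈ multiples → 1 ≢ d
  1∉ d∈ 1≡d with x , _ , refl ← ∈-map⁻ (p *_) d∈ =
    prime∤1 pp (subst (p ∣_) (sym 1≡d) (m∣m*n x))
  unique : Unique (1 ∷ multiples)
  unique = All.tabulate 1∉ ∷ Unique.map⁺ (*-cancelˡ-≡ _ _ p) (divisors-unique (p ^ a))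
  to : ∀ {d} → d ∣ p ^ suc a → d ∈ 1 ∷ multiples
  to {d} d∣@(divides q eq) with factors-of-prime-power pp (suc a) d q (trans (*-comm d q) (sym eq))
  ... | zero , _ , refl , _ = here refl
  ... | suc i , _ , refl , _ = there (∈-map⁺ (p *_) (∈-divisors⁺ (*-cancelˡ-∣ p d∣)))
  from : ∀ {d} → d ∈ 1 ∷ multiples → d ∣ p ^ suc a
  from (here refl) = 1∣ _
  from (there d∈) with x , x∈ , refl ← ∈-map⁻ (p *_) d∈ = *-monoʳ-∣ p (∈-divisors⁻ x∈)

-- Parity

halve : ∀ n → ∃ λ k → n ≡ k + k ⊎ n ≡ suc (k + k)
halve zero = 0 , inj₁ refl
halve (suc n) with halve n
... | k , inj₁ refl = k , inj₂ refl
... | k , inj₂ refl = suc k , inj₁ (cong suc (sym (+-suc k k)))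

n*2≡n+n : ∀ n → n * 2 ≡ n + n
n*2≡n+n = solve-∀

2∣n+n : ∀ n → 2 ∣ n + n
2∣n+n n = divides n (sym (n*2≡n+n n))

odd-1 : Odd 1
odd-1 = prime∤1 prime[2]

even⇒odd-suc : ∀ {n} → 2 ∣ n → Odd (suc n)
even⇒odd-suc {n} 2∣n 2∣1+n = odd-1 (∣m+n∣m⇒∣n (subst (2 ∣_) (+-comm 1 n) 2∣1+n) 2∣n)

odd⇒even-suc : ∀ {n} → Odd n → 2 ∣ suc n
odd⇒even-suc {n} odd with halve n
... | k , inj₁ refl = contradiction (2∣n+n k) odd
... | k , inj₂ refl = subst (2 ∣_) (cong suc (+-suc k k)) (2∣n+n (suc k))

odd-* : ∀ {m n} → Odd m → Odd n → Odd (m * n)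
odd-* {m} {n} odd-m odd-n 2∣mn with euclidsLemma m n prime[2] 2∣mn
... | inj₁ 2∣m = odd-m 2∣m
... | inj₂ 2∣n = odd-n 2∣n

odd-^ : ∀ {m} → Odd m → ∀ n → Odd (m ^ n)
odd-^ {m} odd n = odd ∘ prime∣^⇒∣ prime[2] m n

odd-∣ : ∀ {m n} → Odd n → m ∣ n → Odd m
odd-∣ odd m∣n 2∣m = odd (∣-trans 2∣m m∣n)

geom-even : ∀ {r} → Odd r → ∀ n → 2 ∣ geom r (n + n)
geom-even {r} odd n = subst (2 ∣_) (sym (geom-double r n)) (∣m⇒∣m*n (geom r n) (odd⇒even-suc (odd-^ odd n)))

geom-odd : ∀ {r} → Odd r → ∀ n → Odd (geom r (suc (n + n)))
geom-odd {r} odd n = even⇒odd-suc (∣n⇒∣m*n r (geom-even odd n))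

-- Residues ±1

infix 4 _≡1[mod_] _≡-1[mod_]

_≡1[mod_] : ℕ → ℕ → Set
x ≡1[mod p ] = ∃ λ c → x ≡ 1 + c * p

_≡-1[mod_] : ℕ → ℕ → Set
x ≡-1[mod p ] = p ∣ 1 + x

1*1 : ∀ {p x y} → x ≡1[mod p ] → y ≡1[mod p ] → x * y ≡1[mod p ]
1*1 {p} (c , refl) (d , refl) = c + d + c * d * p , expand p c d
  where
  expand : ∀ p c d → (1 + c * p) * (1 + d * p) ≡ 1 + (c + d + c * d * p) * p
  expand = solve-∀

1^ : ∀ {p x} → x ≡1[mod p ] → ∀ n → x ^ n ≡1[mod p ]
1^ x≡1 zero = 0 , refl
1^ x≡1 (suc n) = 1*1 x≡1 (1^ x≡1 n)

1*-1 : ∀ {p x y} → x ≡1[mod p ] → y ≡-1[mod p ] → x * y ≡-1[mod p ]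
1*-1 {p} {y = y} (c , refl) p∣1+y =
  subst (p ∣_) (expand p c y) (∣m∣n⇒∣m+n p∣1+y (n∣m*n (c * y)))
  where
  expand : ∀ p c y → 1 + y + c * y * p ≡ 1 + (1 + c * p) * y
  expand = solve-∀

-- From x^2 - 1 = (x - 1)(x + 1). Positivity matters because the quotient in `_≡1[mod_]` is a
-- natural number: x = 0 and p = 1 would be a counterexample.
-1*-1 : ∀ {p x} .{{_ : NonZero x}} → x ≡-1[mod p ] → x * x ≡1[mod p ]
-1*-1 {p} {suc x} (divides c eq) = x * c , trans (expand x) (cong suc (trans (cong (x *_) eq) (sym (*-assoc x c p))))
  where
  expand : ∀ x → (1 + x) * (1 + x) ≡ 1 + x * (2 + x)
  expand = solve-∀

^-distribʳ-* : ∀ x y n → (x * y) ^ n ≡ x ^ n * y ^ n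
^-distribʳ-* x y zero = refl
^-distribʳ-* x y (suc n) = trans (cong (x * y *_) (^-distribʳ-* x y n)) (swap x y (x ^ n) (y ^ n))
  where
  swap : ∀ x y a b → x * y * (a * b) ≡ x * a * (y * b)
  swap = solve-∀

-1^odd : ∀ {p x n} .{{_ : NonZero x}} → x ≡-1[mod p ] → Odd n → x ^ n ≡-1[mod p ]
-1^odd {p} {x} {n} x≡-1 odd with halve n
... | k , inj₁ refl = contradiction (2∣n+n k) odd
... | k , inj₂ refl = subst (_≡-1[mod p ]) eq (1*-1 (1^ (-1*-1 x≡-1) k) x≡-1)
  where
  open ≡-Reasoning
  eq : (x * x) ^ k * x ≡ x ^ suc (k + k)
  eq = begin
    (x * x) ^ k * x    ≡⟨ cong (_* x) (^-distribʳ-* x x k) ⟩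
    x ^ k * x ^ k * x  ≡⟨ cong (_* x) (^-distribˡ-+-* x k k) ⟨
    x ^ (k + k) * x    ≡⟨ *-comm (x ^ (k + k)) x ⟩
    x ^ suc (k + k)    ∎

-- If r^K and m^L have residues ±1, this displays the power K L of r^e m as a product of powers of
-- those two.
^-regroup : ∀ r e m K L → (r ^ e * m) ^ (K * L) ≡ (r ^ K) ^ (e * L) * (m ^ L) ^ K
^-regroup r e m K L = begin
  (r ^ e * m) ^ (K * L)              ≡⟨ ^-distribʳ-* (r ^ e) m (K * L) ⟩
  (r ^ e) ^ (K * L) * m ^ (K * L)    ≡⟨ cong₂ _*_ (^-*-assoc r e (K * L)) (cong (m ^_) (*-comm K L)) ⟩
  r ^ (e * (K * L)) * m ^ (L * K)    ≡⟨ cong₂ _*_ (cong (r ^_) (m*[n*o]≡n*[m*o] e K L)) (sym (^-*-assoc m L K)) ⟩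
  r ^ (K * (e * L)) * (m ^ L) ^ K    ≡⟨ cong (_* (m ^ L) ^ K) (^-*-assoc r K (e * L)) ⟨
  (r ^ K) ^ (e * L) * (m ^ L) ^ K    ∎
  where open ≡-Reasoning

-- Odd numbers whose divisor sum is p^j or 2 p^j

module _ {p : ℕ} (pp : Prime p) (odd-p : Odd p) where

  -- The divisor sum is geometric with e + 2 terms. An even number of terms would make it even, but
  -- p^i is odd. Since p divides the sum, it divides (r - 1) times the sum, which is r^(e+2) - 1.
  component-≡1 : ∀ {r} → Prime r → Odd r → ∀ e i → σ (r ^ suc e) ≡ p ^ i →
                 Odd (2 + e) × r ^ (2 + e) ≡1[mod p ]
  component-≡1 {zero} _ odd-r _ _ _ = contradiction (2 ∣0) odd-r
  component-≡1 {r@(suc r-1)} pr odd-r e i σ≡ = odd , r^≡1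
    where
    eq : geom r (2 + e) ≡ p ^ i
    eq = trans (sym (σ-^ pr (suc e))) σ≡
    odd : Odd (2 + e)
    odd (divides k 2+e≡) = odd-^ odd-p i (subst (2 ∣_) (trans (cong (geom r) (sym (trans 2+e≡ (n*2≡n+n k)))) eq) (geom-even odd-r k))
    p∣geom : ∀ i → geom r (2 + e) ≡ p ^ i → p ∣ geom r (2 + e)
    -- For i = 0 the sum would be 1, but it has two or more terms and `r` is a successor.
    p∣geom zero ()
    p∣geom (suc i) eq = subst (p ∣_) (sym eq) (m∣m*n (p ^ i))
    r^≡1 : r ^ (2 + e) ≡1[mod p ]
    r^≡1 with divides c geom≡ ← p∣geom i eq =
      r-1 * c , trans (geom-closed r (2 + e)) (cong suc (trans (cong (r-1 *_) geom≡) (sym (*-assoc r-1 c p))))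

  -- The sum has e + 1 terms and is even, so e + 1 = 2f and it equals (1 + r^f) times a sum of f
  -- terms. Thus 1 + r^f divides 2 p^i, and being greater than 2 it is a multiple of p.
  component-≡-1 : ∀ {r} → Prime r → Odd r → ∀ e i → σ (r ^ e) ≡ 2 * p ^ i →
                  Odd e × ∃ λ f → Odd f × r ^ f ≡-1[mod p ]
  component-≡-1 {r} pr odd-r e i σ≡ with halve e
  ... | k , inj₁ refl = contradiction (subst (2 ∣_) (trans (sym σ≡) (σ-^ pr (k + k))) (m∣m*n (p ^ i))) (geom-odd odd-r k)
  ... | k , inj₂ refl = even⇒odd-suc (2∣n+n k) , f , odd-f , r^f≡-1
    where
    f : ℕ
    f = suc k
    eq : (1 + r ^ f) * geom r f ≡ 2 * p ^ i
    eq = trans (sym (geom-double r f)) (trans (cong (geom r ∘ suc) (+-suc k k)) (trans (sym (σ-^ pr (suc (k + k)))) σ≡))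
    odd-f : Odd f
    -- For even f both factors would be even, so 4 would divide 2 p^i and p would be even.
    odd-f (divides h f≡) = odd-^ odd-p i (*-cancelˡ-∣ 2 (subst (2 * 2 ∣_) eq
      (*-pres-∣ (odd⇒even-suc (odd-^ odd-r f)) (subst (λ n → 2 ∣ geom r n) (sym (trans f≡ (n*2≡n+n h))) (geom-even odd-r h)))))
    r^f≢1 : r ^ f ≢ 1
    r^f≢1 r^f≡1 with m^n≡1⇒n≡0∨m≡1 r f r^f≡1
    ... | inj₂ r≡1 = <⇒≢ (1<prime pr) (sym r≡1)
    r^f≢0 : r ^ f ≢ 0
    r^f≢0 r^f≡0 = ≢-nonZero⁻¹ r {{prime⇒nonZero pr}} (m^n≡0⇒m≡0 r f r^f≡0)
    r^f≡-1 : r ^ f ≡-1[mod p ]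
    r^f≡-1 with factors-of-twice-prime-power pp i (1 + r ^ f) (geom r f) eq
    -- Without a factor p, the number 1 + r^f would be 2 or 1.
    ... | zero , _ , inj₁ (1+r^f≡2 , _) = contradiction (suc-injective 1+r^f≡2) r^f≢1
    ... | zero , _ , inj₂ (1+r^f≡1 , _) = contradiction (suc-injective 1+r^f≡1) r^f≢0
    ... | suc j , _ , inj₁ (1+r^f≡ , _) = subst (p ∣_) (sym 1+r^f≡) (∣n⇒∣m*n 2 (m∣m*n (p ^ j)))
    ... | suc j , _ , inj₂ (1+r^f≡ , _) = subst (p ∣_) (sym 1+r^f≡) (m∣m*n (p ^ j))

  -- Both halves go through one induction, since the second needs the first for the cofactor. Odd
  -- exponents are demanded so that powers of -1 keep their sign.
  OddPowerIs±1 : ℕ → Set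
  OddPowerIs±1 n =
    (∀ j → σ n ≡ p ^ j → ∃ λ K → Odd K × n ^ K ≡1[mod p ]) ×
    (∀ j → σ n ≡ 2 * p ^ j → ∃ λ K → Odd K × n ^ K ≡-1[mod p ])

  -- Strong induction that splits off one full prime power r^(e+1). Multiplicativity distributes p^j
  -- or 2 p^j over the two divisor sums, and the exponents found for the two parts are multiplied.
  odd-power-±1 : ∀ n → Odd n → OddPowerIs±1 n
  odd-power-±1 = <-rec (λ n → Odd n → OddPowerIs±1 n) step
    where
    step : ∀ n → (∀ {k} → k < n → Odd k → OddPowerIs±1 k) → Odd n → OddPowerIs±1 n
    step zero _ odd = contradiction (2 ∣0) odd
    step (suc zero) _ _ =
      (λ _ _ → 1 , odd-1 , 0 , refl) ,
      (λ j 1≡ → contradiction (subst (2 ∣_) (sym 1≡) (m∣m*n (p ^ j))) odd-1)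
    step n@(suc (suc _)) rec odd
      with component r e m pr r∤m n≡ ← prime-component n (s<s z<s)
      = subst OddPowerIs±1 (sym n≡) (case-1 , case-2)
      where
      instance
        r≢0 : NonZero r
        r≢0 = prime⇒nonZero pr
        m≢0 : NonZero m
        m≢0 = ∤⇒nonZero r∤m
      odd-r : Odd r
      odd-r = odd-∣ odd (subst (r ∣_) (sym n≡) (∣m⇒∣m*n m (m∣m*n (r ^ e))))
      m∣n : m ∣ n
      m∣n = subst (m ∣_) (sym n≡) (n∣m*n (r ^ suc e))
      m<n : m < n
      m<n = ≤∧≢⇒< (∣⇒≤ m∣n) λ { refl → r∤m (subst (r ∣_) (sym n≡) (∣m⇒∣m*n m (m∣m*n (r ^ e)))) }
      ih : OddPowerIs±1 m
      ih = rec m<n (odd-∣ odd m∣n)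
      σ-split : σ (r ^ suc e * m) ≡ σ (r ^ suc e) * σ m
      σ-split = σ-component pr (suc e) r∤m

      case-1 : ∀ j → σ (r ^ suc e * m) ≡ p ^ j → ∃ λ K → Odd K × (r ^ suc e * m) ^ K ≡1[mod p ]
      case-1 j σ≡
        with i , l , σr≡ , σm≡ , _ ← factors-of-prime-power pp j _ _ (trans (sym σ-split) σ≡)
        with odd-K , r^K≡1 ← component-≡1 pr odd-r e i σr≡
        with L , odd-L , m^L≡1 ← proj₁ ih l σm≡
        = (2 + e) * L , odd-* odd-K odd-L ,
          subst (_≡1[mod p ]) (sym (^-regroup r (suc e) m (2 + e) L))
            (1*1 (1^ r^K≡1 (suc e * L)) (1^ m^L≡1 (2 + e)))

      case-2 : ∀ j → σ (r ^ suc e * m) ≡ 2 * p ^ j → ∃ λ K → Odd K × (r ^ suc e * m) ^ K ≡-1[mod p ]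
      case-2 j σ≡ with factors-of-twice-prime-power pp j _ _ (trans (sym σ-split) σ≡)
      ... | i , l , inj₁ (σr≡ , σm≡)
        with odd-e , f , odd-f , r^f≡-1 ← component-≡-1 pr odd-r (suc e) i σr≡
        with L , odd-L , m^L≡1 ← proj₁ ih l σm≡
        -- The sign comes from r^f, raised to the odd power (e+1) L; the part (m^L)^f has residue 1.
        = f * L , odd-* odd-f odd-L ,
          subst (_≡-1[mod p ]) (trans (*-comm ((m ^ L) ^ f) _) (sym (^-regroup r (suc e) m f L)))
            (1*-1 (1^ m^L≡1 f) (-1^odd {{m^n≢0 r f}} r^f≡-1 (odd-* odd-e odd-L)))
      ... | i , l , inj₂ (σr≡ , σm≡)
        with odd-K , r^K≡1 ← component-≡1 pr odd-r e i σr≡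
        with L , odd-L , m^L≡-1 ← proj₂ ih l σm≡
        -- Now the sign comes from m^L, raised to the odd power e + 2.
        = (2 + e) * L , odd-* odd-K odd-L ,
          subst (_≡-1[mod p ]) (sym (^-regroup r (suc e) m (2 + e) L))
            (1*-1 (1^ r^K≡1 (suc e * L)) (-1^odd {{m^n≢0 m L}} m^L≡-1 odd-K))

-- The cofactor k

-- This serves k = 1 with a = 1. A prime divisor sum allows only one prime power r^(e+1) in m. As
-- σ(m) is 1 modulo r, the equation 2m = 1 + σ(m) would give r = 2, against m odd.
σ-prime≢2m-1 : ∀ {p m} → Prime p → Odd m → σ m ≡ p → 2 * m ≢ 1 + p
σ-prime≢2m-1 {p} {zero} pp odd σm≡p ()
σ-prime≢2m-1 {p} {suc zero} pp odd refl eq = prime∤1 pp ∣-refl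
σ-prime≢2m-1 {p} {m@(suc (suc _))} pp odd σm≡p eq
  with component r e m′ pr r∤m′ m≡ ← prime-component m (s<s z<s) = odd (subst (_∣ m) r≡2 r∣m)
  where
  instance
    r≢0 : NonZero r
    r≢0 = prime⇒nonZero pr
    m′≢0 : NonZero m′
    m′≢0 = ∤⇒nonZero r∤m′
    p≢0 : NonZero p
    p≢0 = prime⇒nonZero pp
  σ-split : σ (r ^ suc e) * σ m′ ≡ p
  σ-split = trans (sym (σ-component pr (suc e) r∤m′)) (trans (cong σ (sym m≡)) σm≡p)
  σr≡p : σ (r ^ suc e) ≡ p
  σr≡p with prime⇒irreducible pp (subst (σ (r ^ suc e) ∣_) σ-split (m∣m*n (σ m′)))
  ... | inj₂ σr≡p = σr≡p
  ... | inj₁ σr≡1 with () ← geom≡1⇒≡1 r (2 + e) (trans (sym (σ-^ pr (suc e))) σr≡1)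
  m′≡1 : m′ ≡ 1
  m′≡1 = ≤-antisym (subst (m′ ≤_) σm′≡1 (n≤σ m′)) (n≢0⇒n>0 (≢-nonZero⁻¹ m′))
    where
    σm′≡1 : σ m′ ≡ 1
    σm′≡1 = *-cancelˡ-≡ (σ m′) 1 p (trans (cong (_* σ m′) (sym σr≡p)) (trans σ-split (sym (*-identityʳ p))))
  r∣m : r ∣ m
  r∣m = subst (r ∣_) (sym m≡) (∣m⇒∣m*n m′ (m∣m*n (r ^ e)))
  2m≡ : 2 * m ≡ r * geom r (suc e) + 2
  2m≡ = trans eq (trans (cong suc (trans (sym σr≡p) (σ-^ pr (suc e)))) (+-comm 2 (r * geom r (suc e))))
  r≡2 : r ≡ 2
  r≡2 with prime⇒irreducible prime[2] (∣m+n∣m⇒∣n (subst (r ∣_) 2m≡ (∣n⇒∣m*n 2 r∣m)) (m∣m*n (geom r (suc e))))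
  ... | inj₁ refl = contradiction ∣-refl (prime∤1 pr)
  ... | inj₂ r≡2 = r≡2

^-cancelʳ-< : ∀ {m i j} .{{_ : NonZero m}} → m ^ i < m ^ j → i < j
^-cancelʳ-< {m} mⁱ<mʲ = ≰⇒> λ j≤i → <⇒≱ mⁱ<mʲ (^-monoʳ-≤ m j≤i)

σ≡pᵃ⇒2m≢σpᵃ : ∀ {p m} → Prime p → Odd p → Odd m → ∀ a → σ m ≡ p ^ a → 2 * m ≢ geom p (suc a)
σ≡pᵃ⇒2m≢σpᵃ {p} {m} pp odd-p odd-m a σm≡ 2m≡ with halve a
-- For a = 2k the geometric sum has an odd number of odd terms, so it cannot be 2m.
... | k , inj₁ refl = geom-odd odd-p k (subst (2 ∣_) 2m≡ (m∣m*n m))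
... | zero , inj₂ refl = σ-prime≢2m-1 pp odd-m (trans σm≡ (*-identityʳ p)) (trans 2m≡ (simplify p))
  where
  simplify : ∀ p → 1 + p * (1 + p * 0) ≡ 1 + p
  simplify = solve-∀
-- Here a = 2k + 1 with k at least 1, where k is not the cofactor of the main argument. So a + 1 =
-- 2c with c = k + 1, and `u` is half of p^c + 1.
... | k@(suc k-1) , inj₂ refl
  with divides u 1+p^c≡ ← odd⇒even-suc (odd-^ odd-p (suc k)) = absurd
  where
  c : ℕ
  c = suc k
  v : ℕ
  v = geom p c
  instance
    p≢0 : NonZero p
    p≢0 = prime⇒nonZero pp
    u≢0 : NonZero u
    u≢0 = ≢-nonZero λ { refl → 1+n≢0 1+p^c≡ }
  uv≡m : u * v ≡ m
  uv≡m = *-cancelˡ-≡ (u * v) m 2 (begin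
    2 * (u * v)               ≡⟨ m*[n*o]≡n*m*o 2 u v ⟩
    u * 2 * v                 ≡⟨ cong (_* v) 1+p^c≡ ⟨
    (1 + p ^ c) * v           ≡⟨ geom-double p c ⟨
    geom p (c + c)            ≡⟨ cong (geom p ∘ suc) (+-suc k k) ⟩
    geom p (suc (suc (k + k))) ≡⟨ 2m≡ ⟨
    2 * m                     ∎)
    where open ≡-Reasoning
  -- From 2u = 1 + p^c = 2 + (p - 1) v, a common divisor divides 2; it is not 2 because u v = m is
  -- odd.
  u⊥v : Coprime u v
  u⊥v {d} (d∣u , d∣v) with prime⇒irreducible prime[2] d∣2
    where
    d∣2 : d ∣ 2
    d∣2 = ∣m+n∣m⇒∣n
      (subst (d ∣_) (trans (sym 1+p^c≡) (trans (cong suc (geom-closed p c)) (+-comm 2 (pred p * v)))) (∣m⇒∣m*n 2 d∣u))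
      (∣n⇒∣m*n (pred p) d∣v)
  ... | inj₁ d≡1 = d≡1
  ... | inj₂ refl = contradiction (subst (2 ∣_) uv≡m (∣m⇒∣m*n v d∣u)) odd-m
  -- Indeed 2 p^k ≤ p^c < 1 + p^c = 2u.
  p^k<u : p ^ k < u
  p^k<u = *-cancelʳ-< 2 (p ^ k) u (subst (p ^ k * 2 <_) 1+p^c≡
    (s≤s (subst (_≤ p ^ c) (*-comm 2 (p ^ k)) (*-monoˡ-≤ (p ^ k) (1<prime pp)))))
  -- The last term of v is p^k, and k ≥ 1 leaves at least one further term.
  p^k<v : p ^ k < v
  p^k<v = subst (p ^ k <_) (sym v≡) (s≤s (m≤n+m (p ^ k) (p * geom p k-1)))
    where
    v≡ : v ≡ geom p k + p ^ k
    v≡ = trans (cong (geom p) (+-comm 1 k)) (trans (geom-+ p k 1)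
      (cong (geom p k +_) (trans (cong (p ^ k *_) (cong suc (*-zeroʳ p))) (*-identityʳ (p ^ k)))))
  absurd : ⊥
  -- As σ(u) ≥ u > p^k, the exponent i is at least c, and likewise j; then i + j ≥ 2c exceeds a.
  absurd with i , j , σu≡ , σv≡ , i+j≡ ← factors-of-prime-power pp (suc (k + k)) (σ u) (σ v)
                (trans (sym (σ-* u v u⊥v)) (trans (cong σ uv≡m) σm≡)) =
    <⇒≱ (n<1+n (suc (k + k)))
      (subst (_≤ suc (k + k)) (cong suc (+-suc k k)) (subst (c + c ≤_) i+j≡ (+-mono-≤
        (^-cancelʳ-< {p} {k} {i} (subst (p ^ k <_) σu≡ (<-≤-trans p^k<u (n≤σ u))))
        (^-cancelʳ-< {p} {k} {j} (subst (p ^ k <_) σv≡ (<-≤-trans p^k<v (n≤σ v)))))))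

-- This is the case k = 2. Some power m^K is -1 modulo p, yet every power of m = 1 + p(⋯) is 1, so p
-- would divide 2.
σpᵃ⇒σ≢2pᵃ : ∀ {p m} → Prime p → Odd p → Odd m → ∀ a → m ≡ geom p (suc a) → σ m ≢ 2 * p ^ a
σpᵃ⇒σ≢2pᵃ {p} {m} pp odd-p odd-m a m≡ σm≡
  with K , _ , m^K≡-1 ← proj₂ (odd-power-±1 pp odd-p m odd-m) a σm≡
  with c , m^K≡ ← 1^ {p} (geom p a , trans m≡ (cong suc (*-comm p (geom p a)))) K
  with prime⇒irreducible prime[2] (∣m+n∣m⇒∣n (subst (p ∣_) (trans (cong suc m^K≡) (+-comm 2 (c * p))) m^K≡-1) (n∣m*n c))
... | inj₁ refl = prime∤1 pp ∣-refl
... | inj₂ refl = odd-p ∣-refl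

-- The sum 1 + p + ⋯ + p^a is 1 modulo p.
σ[pᵃ]-coprime : ∀ {p} → Prime p → ∀ a → Coprime (σ (p ^ a)) (p ^ a)
σ[pᵃ]-coprime {p} pp a = coprime-sym
  (∤⇒coprime-^ pp (subst (p ∤_) (sym (σ-^ pp a)) (∤geom-suc pp a)) a)

-- The inequality is multiplied through by 3 p^a, which keeps it within the natural numbers.
theorem4p2p5 : (N : ℕ) → OddPerfect N → (p a : ℕ) → Prime p → 0 < a → p ^ a ∥ N →
    3 * (σ (p ^ a) * p ^ a) ≤ 2 * N
theorem4p2p5 N (0<N , odd-N , σN≡2N) p a@(suc a-1) pp 0<a (divides m N≡ , p^[1+a]∤N) =
  bound k-eq
  where
  q : ℕ
  q = p ^ a
  N≡qm : N ≡ q * m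
  N≡qm = trans N≡ (*-comm m q)
  odd-p : Odd p
  odd-p = odd-∣ odd-N (subst (p ∣_) (sym N≡) (∣n⇒∣m*n m (m∣m*n (p ^ a-1))))
  odd-m : Odd m
  odd-m = odd-∣ odd-N (subst (m ∣_) (sym N≡) (m∣m*n q))
  p∤m : p ∤ m
  p∤m p∣m = p^[1+a]∤N (subst (p ^ suc a ∣_) (sym N≡) (*-monoˡ-∣ q p∣m))
  instance
    p≢0 : NonZero p
    p≢0 = prime⇒nonZero pp
    q≢0 : NonZero q
    q≢0 = m^n≢0 p a
    σq≢0 : NonZero (σ q)
    σq≢0 = >-nonZero (<-≤-trans (m^n>0 p a) (n≤σ q))
  σqσm≡ : σ q * σ m ≡ q * (2 * m)
  σqσm≡ = begin
    σ q * σ m     ≡⟨ σ-component pp a p∤m ⟨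
    σ (q * m)     ≡⟨ cong σ N≡qm ⟨
    σ N           ≡⟨ σN≡2N ⟩
    2 * N         ≡⟨ cong (2 *_) N≡qm ⟩
    2 * (q * m)   ≡⟨ m*[n*o]≡n*[m*o] 2 q m ⟩
    q * (2 * m)   ∎
    where open ≡-Reasoning
  -- Being coprime to q, σ(q) divides 2m; the quotient is k, and cancelling σ(q) gives σ(m) = k q.
  k-eq : ∃ λ k → 2 * m ≡ k * σ q × σ m ≡ k * q
  k-eq with divides k 2m≡ ← coprime-divisor (σ[pᵃ]-coprime pp a) (subst (σ q ∣_) σqσm≡ (m∣m*n (σ m))) =
    k , 2m≡ , *-cancelˡ-≡ (σ m) (k * q) (σ q) (trans σqσm≡ (trans (cong (q *_) 2m≡) (move q k (σ q))))
    where
    move : ∀ q k s → q * (k * s) ≡ s * (k * q)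
    move = solve-∀
  bound : (∃ λ k → 2 * m ≡ k * σ q × σ m ≡ k * q) → 3 * (σ q * q) ≤ 2 * N
  -- k = 0 would force m = 0, which is even.
  bound (zero , 2m≡0 , _) =
    contradiction (subst (2 ∣_) (sym (*-cancelˡ-≡ m 0 2 2m≡0)) (2 ∣0)) odd-m
  bound (1 , 2m≡ , σm≡) = contradiction
    (trans 2m≡ (trans (*-identityˡ (σ q)) (σ-^ pp a)))
    (σ≡pᵃ⇒2m≢σpᵃ pp odd-p odd-m a (trans σm≡ (*-identityˡ q)))
  bound (2 , 2m≡ , σm≡) = contradiction σm≡
    (σpᵃ⇒σ≢2pᵃ pp odd-p odd-m a (trans (*-cancelˡ-≡ m (σ q) 2 2m≡) (σ-^ pp a)))
  bound (k@(suc (suc (suc k-3))) , 2m≡ , _) = begin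
    3 * (σ q * q)   ≤⟨ *-monoˡ-≤ (σ q * q) (m≤m+n 3 k-3) ⟩
    k * (σ q * q)   ≡⟨ *-assoc k (σ q) q ⟨
    k * σ q * q     ≡⟨ cong (_* q) 2m≡ ⟨
    2 * m * q       ≡⟨ *-assoc 2 m q ⟩
    2 * (m * q)     ≡⟨ cong (2 *_) N≡ ⟨
    2 * N           ∎
    where open ≤-Reasoning
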